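{- The bimodal provability logic $\mathsf{GLB}$ is $\mathcal{V}$-incomplete.
   Context: $\mathsf{GLB}$ is the smallest normal bimodal logic, in the language with boxes $[0],[1]$ and dual diamonds $\langle0\rangle,\langle1\rangle$, containing the axioms: (i) $[n]([n]p\to p)\to[n]p$ for $n=0,1$; (ii) $[0]p\to[1]p$; (iii) $\langle0\rangle p\to[1]\langle0\rangle p$. (A normal bimodal logic contains all classical tautologies and $[n](p\to q)\to([n]p\to[n]q)$ for each $n$, and is closed under modus ponens, uniform substitution, and necessitation for each $[n]$.) A (bimodal) BAO is a Boolean algebra with two unary operations $\langle0\rangle,\langle1\rangle$, each preserving binary joins and $\bot$; $[n]x=\neg\langle n\rangle\neg x$. It validates a formula if every assignment of elements to propositional variables, extended homomorphically, sends the formula to $\top$. A $\mathcal{V}$-BAO is a BAO in which each operator $\langle n\rangle$ is completely additive: for every set $X$ of elements, if $\bigvee X$ exists, then $\bigvee\{\langle n\rangle x\mid x\in X\}$ exists and equals $\langle n\rangle\bigvee X$. A normal logic is $\mathcal{V}$-complete if it is exactly the set of formulas validated by all members of some class of $\mathcal{V}$-BAOs (equivalently: a formula belongs to the logic iff it is validated by every $\mathcal{V}$-BAO validating the logic); otherwise it is $\mathcal{V}$-incomplete. -}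

module Defs where

open import Level using (Level; 0ℓ; suc; _⊔_)
open import Data.Bool.Base using (Bool; true; false; not; _∨_)
open import Data.Fin.Base using (Fin)
open import Data.Fin.Patterns using (0F; 1F)
open import Data.Nat.Base using (ℕ)
open import Data.Product.Base using (_×_; Σ-syntax; ∃-syntax)
open import Algebra.Core using (Op₁)
open import Algebra.Lattice.Bundles using (BooleanAlgebra)
import Algebra.Lattice.Properties.Lattice as LatticeProperties
open import Function.Bundles using (_⇔_)
open import Relation.Binary.Bundles using (Poset)
open import Relation.Binary.PropositionalEquality.Core using (_≡_)
open import Relation.Unary using (Pred; _∈_; _⊆_)

infixr 5 _⇒_
infix  8 ~_ [_]_ ⟨_⟩_

data Formula : Set where
  var  : ℕ → Formula
  ⊥′   : Formula
  _⇒_  : Formula → Formula → Formula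
  [_]_ : Fin 2 → Formula → Formula

~_ : Formula → Formula
~ φ = φ ⇒ ⊥′

⟨_⟩_ : Fin 2 → Formula → Formula
⟨ n ⟩ φ = ~ [ n ] ~ φ

_[_]ˢ : Formula → (ℕ → Formula) → Formula
var i     [ σ ]ˢ = σ i
⊥′        [ σ ]ˢ = ⊥′
(φ ⇒ ψ)   [ σ ]ˢ = φ [ σ ]ˢ ⇒ ψ [ σ ]ˢ
([ n ] φ) [ σ ]ˢ = [ n ] (φ [ σ ]ˢ)

-- Truth-functional evaluation: boxed formulas are treated as atoms, with
-- arbitrary truth values given by b.
eval : (ℕ → Bool) → (Fin 2 → Formula → Bool) → Formula → Bool
eval v b (var i)   = v i
eval v b ⊥′        = false
eval v b (φ ⇒ ψ)   = not (eval v b φ) ∨ eval v b ψ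
eval v b ([ n ] φ) = b n φ

Tautology : Pred Formula 0ℓ
Tautology φ = ∀ v b → eval v b φ ≡ true

p q : Formula
p = var 0
q = var 1

record IsNormal {ℓ} (L : Pred Formula ℓ) : Set ℓ where
  field
    tautologies   : Tautology ⊆ L
    distribution  : ∀ n → [ n ] (p ⇒ q) ⇒ ([ n ] p ⇒ [ n ] q) ∈ L
    modusPonens   : ∀ {φ ψ} → φ ⇒ ψ ∈ L → φ ∈ L → ψ ∈ L
    substitution  : ∀ σ {φ} → φ ∈ L → φ [ σ ]ˢ ∈ L
    necessitation : ∀ n {φ} → φ ∈ L → [ n ] φ ∈ L

record NormalLogic ℓ : Set (suc ℓ) where
  field
    Theorem  : Pred Formula ℓ
    isNormal : IsNormal Theorem

data GLBAxiom : Pred Formula 0ℓ where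
  löb      : ∀ n → GLBAxiom ([ n ] ([ n ] p ⇒ p) ⇒ [ n ] p)
  monotone : GLBAxiom ([ 0F ] p ⇒ [ 1F ] p)
  persist  : GLBAxiom (⟨ 0F ⟩ p ⇒ [ 1F ] ⟨ 0F ⟩ p)

data ⊢GLB : Pred Formula 0ℓ where
  axiom : ∀ {φ} → GLBAxiom φ → ⊢GLB φ
  taut  : ∀ {φ} → Tautology φ → ⊢GLB φ
  dist  : ∀ n → ⊢GLB ([ n ] (p ⇒ q) ⇒ ([ n ] p ⇒ [ n ] q))
  mp    : ∀ {φ ψ} → ⊢GLB (φ ⇒ ψ) → ⊢GLB φ → ⊢GLB ψ
  sub   : ∀ σ {φ} → ⊢GLB φ → ⊢GLB (φ [ σ ]ˢ)
  nec   : ∀ n {φ} → ⊢GLB φ → ⊢GLB ([ n ] φ)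

GLB : NormalLogic 0ℓ
GLB = record
  { Theorem  = ⊢GLB
  ; isNormal = record
    { tautologies   = taut
    ; distribution  = dist
    ; modusPonens   = mp
    ; substitution  = sub
    ; necessitation = nec
    }
  }

⊢GLB-least : ∀ {ℓ} (L : Pred Formula ℓ) → IsNormal L → GLBAxiom ⊆ L → ⊢GLB ⊆ L
⊢GLB-least L N ax = go
  where
  open IsNormal N
  go : ⊢GLB ⊆ L
  go (axiom a) = ax a
  go (taut t)  = tautologies t
  go (dist n)  = distribution n
  go (mp d e)  = modusPonens (go d) (go e)
  go (sub σ d) = substitution σ (go d)
  go (nec n d) = necessitation n (go d)

record BAO c ℓ : Set (suc (c ⊔ ℓ)) where
  field
    booleanAlgebra : BooleanAlgebra c ℓ

  open BooleanAlgebra booleanAlgebra public renaming (_∨_ to _⋁_; _∧_ to _⋀_)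

  field
    ◇      : Fin 2 → Op₁ Carrier
    ◇-cong : ∀ n {x y} → x ≈ y → ◇ n x ≈ ◇ n y
    ◇-∨    : ∀ n x y → ◇ n (x ⋁ y) ≈ ◇ n x ⋁ ◇ n y
    ◇-⊥    : ∀ n → ◇ n ⊥ ≈ ⊥

  □ : Fin 2 → Op₁ Carrier
  □ n x = ¬ ◇ n (¬ x)

  open Poset (LatticeProperties.poset lattice) public using (_≤_)

  -- "The join of X exists and equals s."
  IsJoin : ∀ {a} → Pred Carrier a → Carrier → Set (c ⊔ ℓ ⊔ a)
  IsJoin X s = (∀ x → x ∈ X → x ≤ s) × (∀ u → (∀ x → x ∈ X → x ≤ u) → s ≤ u)

  ◇-image : ∀ {a} → Fin 2 → Pred Carrier a → Pred Carrier (c ⊔ ℓ ⊔ a)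
  ◇-image n X y = ∃[ x ] (x ∈ X × y ≈ ◇ n x)

  -- Sets of elements are predicates at the level of the algebra itself.  They
  -- need not respect _≈_; a set has the same joins as its closure under _≈_.
  CompletelyAdditive : Fin 2 → Set (suc (c ⊔ ℓ))
  CompletelyAdditive n =
    (X : Pred Carrier (c ⊔ ℓ)) → ∀ s → IsJoin X s → IsJoin (◇-image n X) (◇ n s)

  ⟦_⟧ : Formula → (ℕ → Carrier) → Carrier
  ⟦ var i ⟧   ρ = ρ i
  ⟦ ⊥′ ⟧      ρ = ⊥
  ⟦ φ ⇒ ψ ⟧   ρ = ¬ ⟦ φ ⟧ ρ ⋁ ⟦ ψ ⟧ ρ
  ⟦ [ n ] φ ⟧ ρ = □ n (⟦ φ ⟧ ρ)

  Validates : Formula → Set (c ⊔ ℓ)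
  Validates φ = ∀ ρ → ⟦ φ ⟧ ρ ≈ ⊤

record 𝒱-BAO c ℓ : Set (suc (c ⊔ ℓ)) where
  field
    bao                : BAO c ℓ
    completelyAdditive : ∀ n → BAO.CompletelyAdditive bao n

  open BAO bao public

-- Classes are predicates; the levels c, ℓ of the algebras and k of the class
-- are parameters because there is no quantification over all universes at once.
𝒱-Complete : ∀ (c ℓ k : Level) {a} → NormalLogic a → Set (suc (c ⊔ ℓ ⊔ k) ⊔ a)
𝒱-Complete c ℓ k L =
  Σ[ K ∈ Pred (𝒱-BAO c ℓ) k ]
    (∀ φ → φ ∈ NormalLogic.Theorem L ⇔ (∀ A → A ∈ K → 𝒱-BAO.Validates A φ))

{-# OPTIONS --safe #-}
-- The formula [1]⊥ separates GLB from its 𝒱-BAOs.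
--
-- It holds in every 𝒱-BAO of GLB.  By Löb's axiom for [0], the elements y with
-- y ≤ ¬⟨0⟩y have join ⊤, so by complete additivity ⟨1⟩⊤ is the join of their
-- images ⟨1⟩y.  Each of these is ⊥: ⟨1⟩y ≤ ⟨0⟩y by monotonicity, whereas
-- ⟨1⟩y ≤ ⟨1⟩¬⟨0⟩y = ¬[1]⟨0⟩y ≤ ¬⟨0⟩y by persistence.
--
-- It is not a theorem of GLB.  On the ordinal ω + 1 interpret ⟨0⟩ as the derived
-- set operator of the left topology and ⟨1⟩ as that of the interval topology,
-- restricted to the sets whose trace on ω is finite or cofinite.  This refutes
-- [1]⊥ at the point ω.
module Submission where

open import Defs
open import Level using (Level; _⊔_; Lift; lift)
open import Algebra.Lattice.Bundles using (BooleanAlgebra)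
import Algebra.Lattice.Properties.BooleanAlgebra as BooleanAlgebraProperties
open import Data.Bool.Base using (Bool; true; false; not; _∧_; _∨_; T)
open import Data.Bool.Properties using (T-≡; T-∧)
open import Data.Fin.Base using (Fin)
open import Data.Fin.Patterns using (0F; 1F)
open import Data.Nat.Base using (ℕ; zero; suc; _≤_; _<_; s≤s; s≤s⁻¹) renaming (_⊔_ to _⊔ℕ_)
open import Data.Nat.Properties
  using (≤-refl; ≤-trans; ≤-total; m<n⇒m<1+n; m≤n⇒m<n∨m≡n; n<1+n; m≤m⊔n; m≤n⊔m)
open import Data.Product.Base using (_,_; proj₁; proj₂)
open import Data.Sum.Base using (inj₁; inj₂)
open import Data.Unit.Base using (tt)
open import Function.Base using (_∘_)
open import Function.Bundles using (module Equivalence)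
import Relation.Binary.Lattice as OrderTheoretic
open import Relation.Binary.PropositionalEquality
  using (_≡_; refl; sym; trans; cong; cong₂; subst)
open import Relation.Nullary using (¬_)
open import Relation.Unary using (Pred; _∈_)

open Equivalence using (to; from)

-- Order and complement in a Boolean algebra.

module Complements {c ℓ} (B : BooleanAlgebra c ℓ) where

  open BooleanAlgebra B
    renaming (¬_ to ∁_; _∨_ to _⋁_; _∧_ to _⋀_)
    hiding (refl; sym; trans)
  module ≈ = BooleanAlgebra B using (refl; sym; trans)
  open BooleanAlgebraProperties B
    using (¬-involutive; deMorgan₁; ¬⊥≈⊤; ∧-identityʳ; ∨-identityˡ; ∨-∧-orderTheoreticLattice)
  open OrderTheoretic.Lattice ∨-∧-orderTheoreticLattice public
    using (antisym; x≤x∨y; y≤x∨y; ∨-least; x∧y≤x; x∧y≤y; ∧-greatest; ≤-respˡ-≈; ≤-respʳ-≈)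
    renaming (_≤_ to _⊑_; refl to ⊑-refl; trans to ⊑-trans; reflexive to ⊑-reflexive)
  open import Relation.Binary.Reasoning.Setoid setoid

  -- The form in which valid implications are used. The order is given by `x ≈ x ⋀ y`, so an
  -- equational chain suffices.
  ∁∨-⊤⇒⊑ : ∀ {x y} → ∁ x ⋁ y ≈ ⊤ → x ⊑ y
  ∁∨-⊤⇒⊑ {x} {y} eq = begin
    x                      ≈⟨ ∧-identityʳ x ⟨
    x ⋀ ⊤                  ≈⟨ ∧-congˡ eq ⟨
    x ⋀ (∁ x ⋁ y)          ≈⟨ ∧-distribˡ-∨ x (∁ x) y ⟩
    (x ⋀ ∁ x) ⋁ (x ⋀ y)    ≈⟨ ∨-congʳ (∧-complementʳ x) ⟩
    ⊥ ⋁ (x ⋀ y)            ≈⟨ ∨-identityˡ _ ⟩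
    x ⋀ y                  ∎

  ∁-antitone : ∀ {x y} → x ⊑ y → ∁ y ⊑ ∁ x
  ∁-antitone {x} {y} x≤x∧y =
    ≤-respʳ-≈ (≈.sym (≈.trans (¬-cong x≤x∧y) (deMorgan₁ x y))) (y≤x∨y (∁ x) (∁ y))

  ∁-reflects-⊑ : ∀ {x y} → ∁ x ⊑ ∁ y → y ⊑ x
  ∁-reflects-⊑ h = ≤-respˡ-≈ (¬-involutive _) (≤-respʳ-≈ (¬-involutive _) (∁-antitone h))

  ⊑-∁⇒⊑⊥ : ∀ {x y} → x ⊑ y → x ⊑ ∁ y → x ⊑ ⊥
  ⊑-∁⇒⊑⊥ h k = ≤-respʳ-≈ (∧-complementʳ _) (∧-greatest h k)

  ⊑⊤ : ∀ x → x ⊑ ⊤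
  ⊑⊤ x = ≈.sym (∧-identityʳ x)

  ∁∧-⊥⇒∁∨-⊤ : ∀ {x y} → ∁ y ⋀ x ⊑ ⊥ → ∁ x ⋁ y ≈ ⊤
  ∁∧-⊥⇒∁∨-⊤ {x} {y} h = antisym (⊑⊤ _) (≤-respˡ-≈ ¬⊥≈⊤ (≤-respʳ-≈ eq (∁-antitone h)))
    where
    eq : ∁ (∁ y ⋀ x) ≈ ∁ x ⋁ y
    eq = begin
      ∁ (∁ y ⋀ x)    ≈⟨ deMorgan₁ (∁ y) x ⟩
      ∁ ∁ y ⋁ ∁ x    ≈⟨ ∨-congʳ (¬-involutive y) ⟩
      y ⋁ ∁ x        ≈⟨ ∨-comm y (∁ x) ⟩
      ∁ x ⋁ y        ∎

-- Algebras validating the axioms, and the effect of complete additivity.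

module GLBAlgebra {c ℓ} (A : BAO c ℓ) (valid : ∀ {φ} → GLBAxiom φ → BAO.Validates A φ) where

  open BAO A hiding (_≤_; refl; sym; trans) renaming (¬_ to ∁_)
  open BooleanAlgebraProperties booleanAlgebra using (¬-involutive; ¬⊥≈⊤; ¬⊤≈⊥; ∨-identityʳ)
  open Complements booleanAlgebra

  ◇-mono : ∀ n {x y} → x ⊑ y → ◇ n x ⊑ ◇ n y
  ◇-mono n {x} {y} x≤y = ≤-respʳ-≈
    (≈.trans (≈.sym (◇-∨ n x y)) (◇-cong n (antisym (∨-least x≤y ⊑-refl) (y≤x∨y x y))))
    (x≤x∨y (◇ n x) (◇ n y))

  □-cong : ∀ n {x y} → x ≈ y → □ n x ≈ □ n y
  □-cong n = ¬-cong ∘ ◇-cong n ∘ ¬-cong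

  □-⊤ : ∀ n → □ n ⊤ ≈ ⊤
  □-⊤ n = ≈.trans (¬-cong (≈.trans (◇-cong n ¬⊤≈⊥) (◇-⊥ n))) ¬⊥≈⊤

  □-∁ : ∀ n x → □ n (∁ x) ≈ ∁ ◇ n x
  □-∁ n x = ¬-cong (◇-cong n (¬-involutive x))

  -- ⟨ n ⟩ φ abbreviates ([ n ] (φ ⇒ ⊥′)) ⇒ ⊥′, which explains the joins with ⊥.
  ⟨⟩-◇ : ∀ n x → ∁ □ n (∁ x ⋁ ⊥) ⋁ ⊥ ≈ ◇ n x
  ⟨⟩-◇ n x = ≈.trans (∨-identityʳ _) (≈.trans
    (¬-cong (≈.trans (□-cong n (∨-identityʳ _)) (□-∁ n x))) (¬-involutive _))

  -- The hypothesis makes `∁ □ n x ⋁ x`, and hence its box, equal to `⊤`; Löb's axiom then puts `⊤`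
  -- below `□ n x`.
  löb-rule : ∀ n {x} → □ n x ⊑ x → ⊤ ⊑ x
  löb-rule n {x} □x≤x = ⊑-trans (≤-respˡ-≈ □⟦□x⇒x⟧≈⊤ (∁∨-⊤⇒⊑ (valid (löb n) λ _ → x))) □x≤x
    where
    ∁∨-⊤ : ∁ □ n x ⋁ x ≈ ⊤
    ∁∨-⊤ = ∁∧-⊥⇒∁∨-⊤ (⊑-∁⇒⊑⊥ (⊑-trans (x∧y≤y _ _) □x≤x) (x∧y≤x _ _))

    □⟦□x⇒x⟧≈⊤ : □ n (∁ □ n x ⋁ x) ≈ ⊤
    □⟦□x⇒x⟧≈⊤ = ≈.trans (□-cong n ∁∨-⊤) (□-⊤ n)

  ◇₁⊑◇₀ : ∀ x → ◇ 1F x ⊑ ◇ 0F x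
  ◇₁⊑◇₀ x = ∁-reflects-⊑ (≤-respˡ-≈ (□-∁ 0F x) (≤-respʳ-≈ (□-∁ 1F x)
    (∁∨-⊤⇒⊑ (valid monotone λ _ → ∁ x))))

  ◇₀⊑□₁◇₀ : ∀ x → ◇ 0F x ⊑ □ 1F (◇ 0F x)
  ◇₀⊑□₁◇₀ x = ≤-respˡ-≈ (⟨⟩-◇ 0F x) (≤-respʳ-≈ (□-cong 1F (⟨⟩-◇ 0F x))
    (∁∨-⊤⇒⊑ (valid persist λ _ → x)))

  -- y ≤ ¬⟨0⟩y says that no point of y sees a point of y along ⟨0⟩.
  Discrete : Pred Carrier (c ⊔ ℓ)
  Discrete y = Lift c (y ⊑ ∁ ◇ 0F y)

  discrete-join : IsJoin Discrete ⊤
  discrete-join = (λ y _ → ⊑⊤ y) , least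
    where
    least : ∀ u → (∀ y → y ∈ Discrete → y ⊑ u) → ⊤ ⊑ u
    least u bound = löb-rule 0F (∁∨-⊤⇒⊑ (∁∧-⊥⇒∁∨-⊤ (⊑-∁⇒⊑⊥ y≤u (x∧y≤x _ _))))
      where
      -- The witness collects the points of `∁ u` that see no point of `∁ u`, so it is discrete.
      -- Lying below both `u` and `∁ u`, it vanishes, which gives `□ 0F u ⊑ u`.
      y≤u : ∁ u ⋀ □ 0F u ⊑ u
      y≤u = bound _ (lift (⊑-trans (x∧y≤y _ _) (∁-antitone (◇-mono 0F (x∧y≤x _ _)))))

  ◇₁-discrete : ∀ {y} → y ∈ Discrete → ◇ 1F y ⊑ ⊥
  ◇₁-discrete {y} (lift y≤∁◇y) = ⊑-∁⇒⊑⊥ (◇₁⊑◇₀ y) (⊑-trans (◇-mono 1F y≤∁◇y)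
    (∁-reflects-⊑ (≤-respˡ-≈ (≈.sym (¬-involutive _)) (◇₀⊑□₁◇₀ y))))

  ◇₁-⊤ : CompletelyAdditive 1F → ◇ 1F ⊤ ⊑ ⊥
  ◇₁-⊤ additive = proj₂ (additive Discrete ⊤ discrete-join) ⊥
    λ { _ (y , y∈D , z≈◇y) → ≤-respˡ-≈ (≈.sym z≈◇y) (◇₁-discrete y∈D) }

  □₁-⊥ : CompletelyAdditive 1F → □ 1F ⊥ ≈ ⊤
  □₁-⊥ additive = antisym (⊑⊤ _) (≤-respˡ-≈ ¬⊥≈⊤ (∁-antitone
    (⊑-trans (⊑-reflexive (◇-cong 1F ¬⊥≈⊤)) (◇₁-⊤ additive))))

-- Bounded conjunctions and the finite-cofinite algebra on ω + 1.

all< : (ℕ → Bool) → ℕ → Bool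
all< f zero    = true
all< f (suc n) = all< f n ∧ f n

all<⁺ : ∀ f n → (∀ m → m < n → T (f m)) → T (all< f n)
all<⁺ f zero    _ = tt
all<⁺ f (suc n) h = from T-∧ (all<⁺ f n (λ m m<n → h m (m<n⇒m<1+n m<n)) , h n (n<1+n n))

all<⁻ : ∀ f n → T (all< f n) → ∀ m → m < n → T (f m)
all<⁻ f (suc n) t m m<1+n with m≤n⇒m<n∨m≡n (s≤s⁻¹ m<1+n)
... | inj₁ m<n  = all<⁻ f n (proj₁ (to T-∧ t)) m m<n
... | inj₂ refl = proj₂ (to T-∧ t)

T-injective : ∀ {a b} → (T a → T b) → (T b → T a) → a ≡ b
T-injective {false} {false} _ _ = refl
T-injective {true}  {true}  _ _ = refl
T-injective {false} {true}  _ g with () ← g tt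
T-injective {true}  {false} f _ with () ← f tt

T-⇒⁺ : ∀ {a b} → (T a → T b) → T (not a ∨ b)
T-⇒⁺ {false} _ = tt
T-⇒⁺ {true}  f = f tt

T-⇒⁻ : ∀ {a b} → T (not a ∨ b) → T a → T b
T-⇒⁻ {true} t _ = t

-- A subset of ω + 1 with finite or cofinite trace on ω: onω is constantly atLimit
-- from bound onwards, and atω is independent of onω.
record Region : Set where
  constructor region
  field
    onω     : ℕ → Bool
    atLimit : Bool
    atω     : Bool
    bound   : ℕ
    stable  : ∀ n → bound ≤ n → onω n ≡ atLimit

open Region

-- The value at limit is that on the nonprincipal ultrafilter of the finite-cofinite
-- algebra; with it every connective except the boxes is evaluated pointwise.
data Point : Set where
  fin     : ℕ → Point
  limit ω : Point

_∋_ : Region → Point → Bool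
R ∋ fin n = onω R n
R ∋ limit = atLimit R
R ∋ ω     = atω R

empty : Region
empty = region (λ _ → false) false false 0 (λ _ _ → refl)

_⇛_ : Region → Region → Region
R ⇛ S = region
  (λ n → not (onω R n) ∨ onω S n)
  (not (atLimit R) ∨ atLimit S)
  (not (atω R) ∨ atω S)
  (bound R ⊔ℕ bound S)
  (λ n b≤n → cong₂ (λ a b → not a ∨ b)
    (stable R n (≤-trans (m≤m⊔n _ _) b≤n))
    (stable S n (≤-trans (m≤n⊔m _ _) b≤n)))

-- A finite test decides all of ω: it includes the point `bound R`, whose value recurs at every
-- later point.
everywhere : Region → Bool
everywhere R = all< (onω R) (suc (bound R))

everywhere⁻ : ∀ R → T (everywhere R) → ∀ n → T (onω R n)
everywhere⁻ R t n with ≤-total n (bound R)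
... | inj₁ n≤b = all<⁻ (onω R) _ t n (s≤s n≤b)
... | inj₂ b≤n = subst T (trans (stable R _ ≤-refl) (sym (stable R n b≤n)))
                   (all<⁻ (onω R) _ t (bound R) (n<1+n _))

everywhere⁺ : ∀ R → (∀ n → T (onω R n)) → T (everywhere R)
everywhere⁺ R h = all<⁺ (onω R) _ λ n _ → h n

everywhere⇒limit : ∀ R → T (everywhere R) → T (atLimit R)
everywhere⇒limit R t = subst T (stable R (bound R) ≤-refl) (everywhere⁻ R t (bound R))

-- box 1F refers to atLimit because ω is a limit of a finite-cofinite set precisely
-- when that set is cofinite.
box : Fin 2 → Region → Region
box 0F R = region (all< (onω R)) (everywhere R) (everywhere R) (suc (bound R))
  λ n b<n → T-injective
    (λ t → all<⁺ (onω R) _ λ m m≤b → all<⁻ (onω R) n t m (≤-trans m≤b b<n))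
    (λ t → all<⁺ (onω R) n λ m _ → everywhere⁻ R t m)
box 1F R = region (λ _ → true) true (atLimit R) 0 (λ _ _ → refl)

-- Interpretation of formulas in the algebra of regions.

⟪_⟫ : Formula → (ℕ → Region) → Region
⟪ var i ⟫   ρ = ρ i
⟪ ⊥′ ⟫      ρ = empty
⟪ φ ⇒ ψ ⟫   ρ = ⟪ φ ⟫ ρ ⇛ ⟪ ψ ⟫ ρ
⟪ [ n ] φ ⟫ ρ = box n (⟪ φ ⟫ ρ)

⇛-∋ : ∀ R S x → (R ⇛ S) ∋ x ≡ not (R ∋ x) ∨ (S ∋ x)
⇛-∋ R S (fin n) = refl
⇛-∋ R S limit   = refl
⇛-∋ R S ω       = refl

empty-∋ : ∀ x → empty ∋ x ≡ false
empty-∋ (fin n) = refl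
empty-∋ limit   = refl
empty-∋ ω       = refl

-- At a fixed point the connectives are truth-functional and boxed formulas act as atoms, so
-- tautologies hold there.
eval-∋ : ∀ ρ x φ → eval (λ i → ρ i ∋ x) (λ n ψ → ⟪ [ n ] ψ ⟫ ρ ∋ x) φ ≡ ⟪ φ ⟫ ρ ∋ x
eval-∋ ρ x (var i)   = refl
eval-∋ ρ x ⊥′        = sym (empty-∋ x)
eval-∋ ρ x (φ ⇒ ψ)   = trans
  (cong₂ (λ a b → not a ∨ b) (eval-∋ ρ x φ) (eval-∋ ρ x ψ)) (sym (⇛-∋ (⟪ φ ⟫ ρ) (⟪ ψ ⟫ ρ) x))
eval-∋ ρ x ([ n ] φ) = refl

⟪⟫-[]ˢ : ∀ ρ σ φ → ⟪ φ [ σ ]ˢ ⟫ ρ ≡ ⟪ φ ⟫ (λ i → ⟪ σ i ⟫ ρ)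
⟪⟫-[]ˢ ρ σ (var i)   = refl
⟪⟫-[]ˢ ρ σ ⊥′        = refl
⟪⟫-[]ˢ ρ σ (φ ⇒ ψ)   = cong₂ _⇛_ (⟪⟫-[]ˢ ρ σ φ) (⟪⟫-[]ˢ ρ σ ψ)
⟪⟫-[]ˢ ρ σ ([ n ] φ) = cong (box n) (⟪⟫-[]ˢ ρ σ φ)

_⊆ᴿ_ : Region → Region → Set
R ⊆ᴿ S = ∀ x → T (R ∋ x) → T (S ∋ x)

⊆ᴿ⇒⇛ : ∀ R S → R ⊆ᴿ S → ∀ x → T ((R ⇛ S) ∋ x)
⊆ᴿ⇒⇛ R S h x = subst T (sym (⇛-∋ R S x)) (T-⇒⁺ (h x))

⇛⇒⊆ᴿ : ∀ R S x → T ((R ⇛ S) ∋ x) → T (R ∋ x) → T (S ∋ x)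
⇛⇒⊆ᴿ R S x t = T-⇒⁻ (subst T (⇛-∋ R S x) t)

-- Soundness of the model and refutation of [1]⊥.

box-full : ∀ n R → (∀ x → T (R ∋ x)) → ∀ x → T (box n R ∋ x)
box-full 0F R h (fin n) = all<⁺ (onω R) n λ m _ → h (fin m)
box-full 0F R h limit   = everywhere⁺ R (h ∘ fin)
box-full 0F R h ω       = everywhere⁺ R (h ∘ fin)
box-full 1F R h (fin n) = tt
box-full 1F R h limit   = tt
box-full 1F R h ω       = h limit

box-K : ∀ n R S x → T (box n (R ⇛ S) ∋ x) → T (box n R ∋ x) → T (box n S ∋ x)
box-K 0F R S (fin n) t u =
  all<⁺ (onω S) n λ m m<n → T-⇒⁻ (all<⁻ (onω (R ⇛ S)) n t m m<n) (all<⁻ (onω R) n u m m<n)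
box-K 0F R S limit   t u = everywhere⁺ S λ n → T-⇒⁻ (everywhere⁻ (R ⇛ S) t n) (everywhere⁻ R u n)
box-K 0F R S ω       t u = everywhere⁺ S λ n → T-⇒⁻ (everywhere⁻ (R ⇛ S) t n) (everywhere⁻ R u n)
box-K 1F R S (fin n) t u = tt
box-K 1F R S limit   t u = tt
box-K 1F R S ω       t u = T-⇒⁻ t u

-- Löb's axiom for `0F` is strong induction along ω.
all<-löb : ∀ f n → T (all< (λ m → not (all< f m) ∨ f m) n) → T (all< f n)
all<-löb f zero    t = tt
all<-löb f (suc n) t = from T-∧ (ih , T-⇒⁻ (proj₂ (to T-∧ t)) ih)
  where
  ih : T (all< f n)
  ih = all<-löb f n (proj₁ (to T-∧ t))

everywhere-löb : ∀ R → T (everywhere (box 0F R ⇛ R)) → T (everywhere R)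
everywhere-löb R t = all<-löb (onω R) (suc (bound R))
  (all<⁺ (onω (box 0F R ⇛ R)) (suc (bound R)) λ n _ → everywhere⁻ (box 0F R ⇛ R) t n)

box-löb : ∀ n R → box n (box n R ⇛ R) ⊆ᴿ box n R
box-löb 0F R (fin n) t = all<-löb (onω R) n t
box-löb 0F R limit   t = everywhere-löb R t
box-löb 0F R ω       t = everywhere-löb R t
box-löb 1F R (fin n) t = tt
box-löb 1F R limit   t = tt
-- Since `box 1F R` is true at `limit`, the implication there computes to `atLimit R`, which is the
-- goal.
box-löb 1F R ω       t = t

box-monotone : ∀ R → box 0F R ⊆ᴿ box 1F R
box-monotone R (fin n) t = tt
box-monotone R limit   t = tt
box-monotone R ω       t = everywhere⇒limit R t

-- `box 0F R` has the same value at `limit` and `ω`, so at `ω` premise and conclusion coincide.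
box-persist : ∀ R → (box 0F R ⇛ empty) ⊆ᴿ box 1F (box 0F R ⇛ empty)
box-persist R (fin n) t = tt
box-persist R limit   t = tt
box-persist R ω       t = t

-- The claim includes `limit` because necessitation for `1F` at `ω` needs the value there.
sound : ∀ {φ} → ⊢GLB φ → ∀ ρ x → T (⟪ φ ⟫ ρ ∋ x)
sound (axiom (löb n))  ρ   = ⊆ᴿ⇒⇛ (box n (box n (ρ 0) ⇛ ρ 0)) (box n (ρ 0)) (box-löb n (ρ 0))
sound (axiom monotone) ρ   = ⊆ᴿ⇒⇛ (box 0F (ρ 0)) (box 1F (ρ 0)) (box-monotone (ρ 0))
sound (axiom persist)  ρ   = ⊆ᴿ⇒⇛ (box 0F (ρ 0 ⇛ empty) ⇛ empty)
  (box 1F (box 0F (ρ 0 ⇛ empty) ⇛ empty)) (box-persist (ρ 0 ⇛ empty))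
sound (taut {φ} t)     ρ x = subst T (eval-∋ ρ x φ) (from T-≡ (t _ _))
sound (dist n)         ρ   = ⊆ᴿ⇒⇛ (box n (ρ 0 ⇛ ρ 1)) (box n (ρ 0) ⇛ box n (ρ 1))
  λ x t → subst T (sym (⇛-∋ (box n (ρ 0)) (box n (ρ 1)) x)) (T-⇒⁺ (box-K n (ρ 0) (ρ 1) x t))
sound (mp {φ} {ψ} d e) ρ x = ⇛⇒⊆ᴿ (⟪ φ ⟫ ρ) (⟪ ψ ⟫ ρ) x (sound d ρ x) (sound e ρ x)
sound (sub σ {φ} d)    ρ x = subst (λ R → T (R ∋ x)) (sym (⟪⟫-[]ˢ ρ σ φ)) (sound d _ x)
sound (nec n {φ} d)    ρ   = box-full n (⟪ φ ⟫ ρ) (sound d ρ)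

-- At `ω` the formula takes the value `atLimit empty`, which is `false`.
⊬[1]⊥ : ¬ ⊢GLB ([ 1F ] ⊥′)
⊬[1]⊥ d = sound d (λ _ → empty) ω

theorem5p4 : (c ℓ k : Level) → ¬ 𝒱-Complete c ℓ k GLB
theorem5p4 c ℓ k (K , complete) = ⊬[1]⊥ (from (complete _) validates-[1]⊥)
  where
  validates-[1]⊥ : ∀ A → A ∈ K → 𝒱-BAO.Validates A ([ 1F ] ⊥′)
  validates-[1]⊥ A A∈K _ =
    -- The axioms are theorems, so every member of `K` validates them.
    GLBAlgebra.□₁-⊥ bao (λ a → to (complete _) (axiom a) A A∈K) (completelyAdditive 1F)
    where open 𝒱-BAO A
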